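{- Let $a,b,c$ be nonzero real numbers, let $w_0,w_1$ be arbitrary real initial values, let $\{w_n\}$ be the associated generalized bi-periodic Horadam sequence and $\{u_n\}$ the generalized bi-periodic Fibonacci sequence. Then for any positive integers $n$ and $p$, $$w_{n+p}=\left(\frac ba\right)^{\zeta(n+1)\zeta(p)}u_n w_{p+1}+c\left(\frac ba\right)^{\zeta(n)\zeta(p+1)}u_{n-1}w_p.$$
   Context: For nonzero real numbers $a,b,c$ and real initial values $w_0,w_1$, the generalized bi-periodic Horadam sequence $\{w_n\}$ is defined by $w_n=\chi(n)w_{n-1}+c\,w_{n-2}$ for $n\ge 2$, where $\chi(n)=a$ if $n$ is even and $\chi(n)=b$ if $n$ is odd. The generalized bi-periodic Fibonacci sequence $\{u_n\}$ satisfies the same recurrence (same $a,b,c$) with $u_0=0$, $u_1=1$. The parity function is $\zeta(n)=0$ if $n$ is even and $\zeta(n)=1$ if $n$ is odd. -}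

module Defs where

open import Algebra.Bundles using (CommutativeRing)
open import Data.Nat.Base as ℕ using (ℕ; zero; suc; parity)
import Data.Nat.Properties as ℕ
open import Data.Parity.Base using (Parity; 0ℙ; 1ℙ)
open import Data.Product.Base using (∃-syntax; _×_; _,_)
open import Data.Rational.Base as ℚ using (ℚ; 0ℚ; 1ℚ; ½; ∣_∣)
import Data.Rational.Properties as ℚ
import Data.Rational.Solver as ℚ-Solver
open import Level using (0ℓ)
open import Relation.Binary.PropositionalEquality
  using (_≡_; refl; sym; trans; cong; cong₂; subst; module ≡-Reasoning)
open import Relation.Nullary.Decidable using (yes; no)
open import Relation.Nullary.Negation using (contradiction)

-- Real numbers as Cauchy sequences of rationals. Every existential below
-- carries a witness, so moduli of convergence are part of the data; this
-- is the Bishop-style real line, with equality a setoid relation.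

Null : (ℕ → ℚ) → Set
Null f = ∀ ε → ε ℚ.> 0ℚ → ∃[ N ] (∀ n → n ℕ.≥ N → ∣ f n ∣ ℚ.< ε)

-- g m n tends to 0 as m and n tend to infinity independently.
Null₂ : (ℕ → ℕ → ℚ) → Set
Null₂ g = ∀ ε → ε ℚ.> 0ℚ →
  ∃[ N ] (∀ m n → m ℕ.≥ N → n ℕ.≥ N → ∣ g m n ∣ ℚ.< ε)

record ℝ : Set where
  no-eta-equality
  constructor mkℝ
  field
    seq    : ℕ → ℚ
    cauchy : Null₂ (λ m n → seq m ℚ.- seq n)

open ℝ public

infix 4 _≈_ _#_

record _≈_ (x y : ℝ) : Set where
  constructor mk≈
  field
    null : Null (λ n → seq x n ℚ.- seq y n)

open _≈_ public

-- Apartness, the constructive (and classically equivalent) form of x ≠ y;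
-- it is what makes the reciprocal below definable.
record _#_ (x y : ℝ) : Set where
  constructor mk#
  field
    {gap}     : ℚ
    {from}    : ℕ
    gap>0     : gap ℚ.> 0ℚ
    separated : ∀ n → n ℕ.≥ from → gap ℚ.≤ ∣ seq x n ℚ.- seq y n ∣

open _#_ public

private

  module S = ℚ-Solver.+-*-Solver
  open S using (solve; _:=_; _:+_; _:*_; :-_; _:-_; con)

  Bounded₂ : (ℕ → ℕ → ℚ) → Set
  Bounded₂ g = ∃[ K ] (K ℚ.> 0ℚ ×
    ∃[ N ] (∀ m n → m ℕ.≥ N → n ℕ.≥ N → ∣ g m n ∣ ℚ.≤ K))

  null⇒null₂ : ∀ {f} → Null f → Null₂ (λ n _ → f n)
  null⇒null₂ h ε ε>0 with h ε ε>0
  ... | N , p = N , λ m _ m≥N _ → p m m≥N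

  null₂⇒null : ∀ {f} → Null₂ (λ n _ → f n) → Null f
  null₂⇒null h ε ε>0 with h ε ε>0
  ... | N , p = N , λ n n≥N → p n n n≥N n≥N

  null₂-cong-from : ∀ {f g} M →
    (∀ m n → m ℕ.≥ M → n ℕ.≥ M → f m n ≡ g m n) → Null₂ f → Null₂ g
  null₂-cong-from M f≡g h ε ε>0 with h ε ε>0
  ... | N , p = M ℕ.⊔ N , λ m n m≥ n≥ →
    subst (λ q → ∣ q ∣ ℚ.< ε)
          (f≡g m n (ℕ.m⊔n≤o⇒m≤o M N m≥) (ℕ.m⊔n≤o⇒m≤o M N n≥))
          (p m n (ℕ.m⊔n≤o⇒n≤o M N m≥) (ℕ.m⊔n≤o⇒n≤o M N n≥))

  null₂-cong : ∀ {f g} → (∀ m n → f m n ≡ g m n) → Null₂ f → Null₂ g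
  null₂-cong f≡g = null₂-cong-from 0 (λ m n _ _ → f≡g m n)

  null-cong : ∀ {f g} → (∀ n → f n ≡ g n) → Null f → Null g
  null-cong f≡g h = null₂⇒null (null₂-cong (λ m _ → f≡g m) (null⇒null₂ h))

  half>0 : ∀ {ε} → ε ℚ.> 0ℚ → ε ℚ.* ½ ℚ.> 0ℚ
  half>0 {ε} ε>0 =
    ℚ.positive⁻¹ (ε ℚ.* ½) {{ℚ.pos*pos⇒pos ε {{ℚ.positive ε>0}} ½}}

  half+half : ∀ ε → ε ℚ.* ½ ℚ.+ ε ℚ.* ½ ≡ ε
  half+half ε = trans (sym (ℚ.*-distribˡ-+ ε ½ ½)) (ℚ.*-identityʳ ε)

  null₂-+ : ∀ {f g} → Null₂ f → Null₂ g → Null₂ (λ m n → f m n ℚ.+ g m n)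
  null₂-+ {f} {g} hf hg ε ε>0
    with hf (ε ℚ.* ½) (half>0 ε>0) | hg (ε ℚ.* ½) (half>0 ε>0)
  ... | M , p | N , q = M ℕ.⊔ N , λ m n m≥ n≥ →
    let open ℚ.≤-Reasoning in begin-strict
      ∣ f m n ℚ.+ g m n ∣      ≤⟨ ℚ.∣p+q∣≤∣p∣+∣q∣ (f m n) (g m n) ⟩
      ∣ f m n ∣ ℚ.+ ∣ g m n ∣  <⟨ ℚ.+-mono-<
                                    (p m n (ℕ.m⊔n≤o⇒m≤o M N m≥) (ℕ.m⊔n≤o⇒m≤o M N n≥))
                                    (q m n (ℕ.m⊔n≤o⇒n≤o M N m≥) (ℕ.m⊔n≤o⇒n≤o M N n≥)) ⟩
      ε ℚ.* ½ ℚ.+ ε ℚ.* ½      ≡⟨ half+half ε ⟩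
      ε                        ∎

  null₂-neg : ∀ {f} → Null₂ f → Null₂ (λ m n → ℚ.- f m n)
  null₂-neg {f} h ε ε>0 with h ε ε>0
  ... | N , p = N , λ m n m≥ n≥ →
    subst (ℚ._< ε) (sym (ℚ.∣-p∣≡∣p∣ (f m n))) (p m n m≥ n≥)

  null₂-* : ∀ {f g} → Null₂ f → Bounded₂ g → Null₂ (λ m n → f m n ℚ.* g m n)
  null₂-* {f} {g} hf (K , K>0 , N , q) ε ε>0 = go
    where
    instance
      K-pos : ℚ.Positive K
      K-pos = ℚ.positive K>0
      K-nonNeg : ℚ.NonNegative K
      K-nonNeg = ℚ.pos⇒nonNeg K
      K-nonZero : ℚ.NonZero K
      K-nonZero = ℚ.pos⇒nonZero K
    δ : ℚ
    δ = ε ℚ.* ℚ.1/ K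
    δ>0 : δ ℚ.> 0ℚ
    δ>0 = ℚ.positive⁻¹ δ
      {{ℚ.pos*pos⇒pos ε {{ℚ.positive ε>0}} (ℚ.1/ K) {{ℚ.1/pos⇒pos K}}}}
    δK≡ε : δ ℚ.* K ≡ ε
    δK≡ε = trans (ℚ.*-assoc ε (ℚ.1/ K) K)
             (trans (cong (ε ℚ.*_) (ℚ.*-inverseˡ K)) (ℚ.*-identityʳ ε))
    go : ∃[ N ] (∀ m n → m ℕ.≥ N → n ℕ.≥ N → ∣ f m n ℚ.* g m n ∣ ℚ.< ε)
    go with hf δ δ>0
    ... | M , p = M ℕ.⊔ N , λ m n m≥ n≥ →
      let open ℚ.≤-Reasoning in begin-strict
        ∣ f m n ℚ.* g m n ∣
          ≡⟨ ℚ.∣p*q∣≡∣p∣*∣q∣ (f m n) (g m n) ⟩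
        ∣ f m n ∣ ℚ.* ∣ g m n ∣
          ≤⟨ ℚ.*-monoˡ-≤-nonNeg ∣ f m n ∣ {{ℚ.∣-∣-nonNeg (f m n)}}
               (q m n (ℕ.m⊔n≤o⇒n≤o M N m≥) (ℕ.m⊔n≤o⇒n≤o M N n≥)) ⟩
        ∣ f m n ∣ ℚ.* K
          <⟨ ℚ.*-monoˡ-<-pos K
               (p m n (ℕ.m⊔n≤o⇒m≤o M N m≥) (ℕ.m⊔n≤o⇒m≤o M N n≥)) ⟩
        δ ℚ.* K
          ≡⟨ δK≡ε ⟩
        ε ∎

  bounded-swap : ∀ {g} → Bounded₂ g → Bounded₂ (λ m n → g n m)
  bounded-swap (K , K>0 , N , q) = K , K>0 , N , λ m n m≥ n≥ → q n m n≥ m≥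

  1>0 : 1ℚ ℚ.> 0ℚ
  1>0 = ℚ.positive⁻¹ 1ℚ

  seq-bounded : ∀ x → Bounded₂ (λ m _ → seq x m)
  seq-bounded x with cauchy x 1ℚ 1>0
  ... | N , p = 1ℚ ℚ.+ ∣ seq x N ∣
      , ℚ.positive⁻¹ (1ℚ ℚ.+ ∣ seq x N ∣)
          {{ℚ.pos+nonNeg⇒pos 1ℚ ∣ seq x N ∣ {{ℚ.∣-∣-nonNeg (seq x N)}}}}
      , N , λ m _ m≥ _ → let open ℚ.≤-Reasoning in begin
        ∣ seq x m ∣
          ≡⟨ cong ∣_∣ (solve 2 (λ a b → a := (a :- b) :+ b) refl (seq x m) (seq x N)) ⟩
        ∣ (seq x m ℚ.- seq x N) ℚ.+ seq x N ∣
          ≤⟨ ℚ.∣p+q∣≤∣p∣+∣q∣ (seq x m ℚ.- seq x N) (seq x N) ⟩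
        ∣ seq x m ℚ.- seq x N ∣ ℚ.+ ∣ seq x N ∣
          ≤⟨ ℚ.+-monoˡ-≤ ∣ seq x N ∣ (ℚ.<⇒≤ (p m N m≥ ℕ.≤-refl)) ⟩
        1ℚ ℚ.+ ∣ seq x N ∣ ∎

  null-0 : ∀ {f} → (∀ n → f n ≡ 0ℚ) → Null f
  null-0 f≡0 ε ε>0 = 0 , λ n _ → subst (λ q → ∣ q ∣ ℚ.< ε) (sym (f≡0 n)) ε>0

  a-b≡0 : ∀ {a b} → a ≡ b → a ℚ.- b ≡ 0ℚ
  a-b≡0 {a} refl = ℚ.+-inverseʳ a

  pointwise : ∀ {x y} → (∀ n → seq x n ≡ seq y n) → x ≈ y
  pointwise e = mk≈ (null-0 (λ n → a-b≡0 (e n)))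

infixl 6 _+_
infixl 7 _*_
infix  8 -_

fromℚ : ℚ → ℝ
fromℚ q = mkℝ (λ _ → q) λ ε ε>0 →
  0 , λ _ _ _ _ → subst (λ r → ∣ r ∣ ℚ.< ε) (sym (ℚ.+-inverseʳ q)) ε>0

0ℝ 1ℝ : ℝ
0ℝ = fromℚ 0ℚ
1ℝ = fromℚ 1ℚ

_+_ : ℝ → ℝ → ℝ
x + y = mkℝ (λ n → seq x n ℚ.+ seq y n)
  (null₂-cong
    (λ m n → solve 4 (λ a b c d → (a :- b) :+ (c :- d) := (a :+ c) :- (b :+ d)) refl
               (seq x m) (seq x n) (seq y m) (seq y n))
    (null₂-+ (cauchy x) (cauchy y)))

-_ : ℝ → ℝ
- x = mkℝ (λ n → ℚ.- seq x n)
  (null₂-cong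
    (λ m n → solve 2 (λ a b → :- (a :- b) := (:- a) :- (:- b)) refl (seq x m) (seq x n))
    (null₂-neg (cauchy x)))

_*_ : ℝ → ℝ → ℝ
x * y = mkℝ (λ n → seq x n ℚ.* seq y n)
  (null₂-cong
    (λ m n → solve 4 (λ a b c d → (a :- b) :* c :+ (c :- d) :* b := a :* c :- b :* d) refl
               (seq x m) (seq x n) (seq y m) (seq y n))
    (null₂-+ (null₂-* (cauchy x) (seq-bounded y))
             (null₂-* (cauchy y) (bounded-swap (seq-bounded x)))))

-- Total reciprocal on ℚ with the junk value 0 at 0: a sequence apart from 0
-- may still vanish at finitely many indices.
recip : ℚ → ℚ
recip q with q ℚ.≟ 0ℚ
... | yes _   = 0ℚ
... | no  q≢0 = (ℚ.1/ q) {{ℚ.≢-nonZero q≢0}}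

private

  recip-inverse : ∀ {δ q} → δ ℚ.> 0ℚ → δ ℚ.≤ ∣ q ∣ → q ℚ.* recip q ≡ 1ℚ
  recip-inverse {δ} {q} δ>0 δ≤∣q∣ with q ℚ.≟ 0ℚ
  ... | yes refl = contradiction (ℚ.<-≤-trans δ>0 δ≤∣q∣) (ℚ.<-irrefl refl)
  ... | no  q≢0  = ℚ.*-inverseʳ q {{ℚ.≢-nonZero q≢0}}

  away-from-0 : ∀ {x} (x#0 : x # 0ℝ) n → n ℕ.≥ from x#0 → gap x#0 ℚ.≤ ∣ seq x n ∣
  away-from-0 {x} x#0 n n≥ =
    subst (λ q → gap x#0 ℚ.≤ ∣ q ∣) (ℚ.+-identityʳ (seq x n)) (separated x#0 n n≥)

  recip-bounded : ∀ {x} → x # 0ℝ → Bounded₂ (λ m _ → recip (seq x m))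
  recip-bounded {x} x#0 = ℚ.1/ δ , ℚ.positive⁻¹ (ℚ.1/ δ) {{ℚ.1/pos⇒pos δ}}
    , from x#0 , λ m _ m≥ _ → ℚ.*-cancelʳ-≤-pos δ (bound (seq x m) (away-from-0 x#0 m m≥))
    where
    δ : ℚ
    δ = gap x#0
    instance
      δ-pos : ℚ.Positive δ
      δ-pos = ℚ.positive (gap>0 x#0)
      δ-nonZero : ℚ.NonZero δ
      δ-nonZero = ℚ.pos⇒nonZero δ
    bound : ∀ q → δ ℚ.≤ ∣ q ∣ → ∣ recip q ∣ ℚ.* δ ℚ.≤ ℚ.1/ δ ℚ.* δ
    bound q δ≤∣q∣ = let open ℚ.≤-Reasoning in begin
      ∣ recip q ∣ ℚ.* δ      ≤⟨ ℚ.*-monoˡ-≤-nonNeg ∣ recip q ∣ {{ℚ.∣-∣-nonNeg (recip q)}} δ≤∣q∣ ⟩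
      ∣ recip q ∣ ℚ.* ∣ q ∣  ≡⟨ ℚ.∣p*q∣≡∣p∣*∣q∣ (recip q) q ⟨
      ∣ recip q ℚ.* q ∣      ≡⟨ cong ∣_∣ (trans (ℚ.*-comm (recip q) q) (recip-inverse (gap>0 x#0) δ≤∣q∣)) ⟩
      1ℚ                     ≡⟨ ℚ.*-inverseˡ δ ⟨
      ℚ.1/ δ ℚ.* δ           ∎

  recip-difference : ∀ q r s t → q ℚ.* s ≡ 1ℚ → r ℚ.* t ≡ 1ℚ →
    (ℚ.- (q ℚ.- r)) ℚ.* s ℚ.* t ≡ s ℚ.- t
  recip-difference q r s t qs≡1 rt≡1 = begin
    (ℚ.- (q ℚ.- r)) ℚ.* s ℚ.* t
      ≡⟨ solve 4 (λ q r s t → (:- (q :- r)) :* s :* t := s :* (r :* t) :- t :* (q :* s))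
           refl q r s t ⟩
    s ℚ.* (r ℚ.* t) ℚ.- t ℚ.* (q ℚ.* s)
      ≡⟨ cong₂ (λ a b → s ℚ.* a ℚ.- t ℚ.* b) rt≡1 qs≡1 ⟩
    s ℚ.* 1ℚ ℚ.- t ℚ.* 1ℚ
      ≡⟨ cong₂ ℚ._-_ (ℚ.*-identityʳ s) (ℚ.*-identityʳ t) ⟩
    s ℚ.- t ∎
    where open ≡-Reasoning

inverse : (x : ℝ) → x # 0ℝ → ℝ
inverse x x#0 = mkℝ (λ n → recip (seq x n))
  (null₂-cong-from (from x#0)
    (λ m n m≥ n≥ → recip-difference (seq x m) (seq x n) (recip (seq x m)) (recip (seq x n))
       (recip-inverse (gap>0 x#0) (away-from-0 x#0 m m≥))
       (recip-inverse (gap>0 x#0) (away-from-0 x#0 n n≥)))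
    (null₂-* (null₂-* (null₂-neg (cauchy x)) (recip-bounded x#0))
             (bounded-swap (recip-bounded x#0))))

infixl 7 _/_[_]

_/_[_] : (x y : ℝ) → y # 0ℝ → ℝ
x / y [ y#0 ] = x * inverse y y#0

*-inverseʳ : ∀ x (x#0 : x # 0ℝ) → x * inverse x x#0 ≈ 1ℝ
*-inverseʳ x x#0 = mk≈ λ ε ε>0 → from x#0 , λ n n≥ →
  subst (λ q → ∣ q ∣ ℚ.< ε)
        (sym (a-b≡0 (recip-inverse (gap>0 x#0) (away-from-0 x#0 n n≥)))) ε>0

private

  ≈-refl : ∀ {x} → x ≈ x
  ≈-refl = pointwise λ _ → refl

  ≈-sym : ∀ {x y} → x ≈ y → y ≈ x
  ≈-sym {x} {y} (mk≈ h) = mk≈ (null-cong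
    (λ n → solve 2 (λ a b → :- (a :- b) := b :- a) refl (seq x n) (seq y n))
    (null₂⇒null (null₂-neg (null⇒null₂ h))))

  ≈-trans : ∀ {x y z} → x ≈ y → y ≈ z → x ≈ z
  ≈-trans {x} {y} {z} (mk≈ h) (mk≈ k) = mk≈ (null-cong
    (λ n → solve 3 (λ a b c → (a :- b) :+ (b :- c) := a :- c) refl
             (seq x n) (seq y n) (seq z n))
    (null₂⇒null (null₂-+ (null⇒null₂ h) (null⇒null₂ k))))

  +-cong : ∀ {x x′ y y′} → x ≈ x′ → y ≈ y′ → x + y ≈ x′ + y′
  +-cong {x} {x′} {y} {y′} (mk≈ h) (mk≈ k) = mk≈ (null-cong
    (λ n → solve 4 (λ a b c d → (a :- b) :+ (c :- d) := (a :+ c) :- (b :+ d)) refl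
             (seq x n) (seq x′ n) (seq y n) (seq y′ n))
    (null₂⇒null (null₂-+ (null⇒null₂ h) (null⇒null₂ k))))

  -‿cong : ∀ {x y} → x ≈ y → - x ≈ - y
  -‿cong {x} {y} (mk≈ h) = mk≈ (null-cong
    (λ n → solve 2 (λ a b → :- (a :- b) := (:- a) :- (:- b)) refl (seq x n) (seq y n))
    (null₂⇒null (null₂-neg (null⇒null₂ h))))

  *-cong : ∀ {x x′ y y′} → x ≈ x′ → y ≈ y′ → x * y ≈ x′ * y′
  *-cong {x} {x′} {y} {y′} (mk≈ h) (mk≈ k) = mk≈ (null-cong
    (λ n → solve 4 (λ a b c d → (a :- b) :* c :+ (c :- d) :* b := a :* c :- b :* d) refl
             (seq x n) (seq x′ n) (seq y n) (seq y′ n))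
    (null₂⇒null (null₂-+ (null₂-* (null⇒null₂ h) (seq-bounded y))
                         (null₂-* (null⇒null₂ k) (seq-bounded x′)))))

ℝ-commutativeRing : CommutativeRing 0ℓ 0ℓ
ℝ-commutativeRing = record
  { Carrier = ℝ
  ; _≈_ = _≈_
  ; _+_ = _+_
  ; _*_ = _*_
  ; -_  = -_
  ; 0#  = 0ℝ
  ; 1#  = 1ℝ
  ; isCommutativeRing = record
    { isRing = record
      { +-isAbelianGroup = record
        { isGroup = record
          { isMonoid = record
            { isSemigroup = record
              { isMagma = record
                { isEquivalence = record { refl = ≈-refl ; sym = ≈-sym ; trans = ≈-trans }
                ; ∙-cong = +-cong
                }
              ; assoc = λ x y z → pointwise λ n → ℚ.+-assoc (seq x n) (seq y n) (seq z n)
              }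
            ; identity = (λ x → pointwise λ n → ℚ.+-identityˡ (seq x n))
                       , (λ x → pointwise λ n → ℚ.+-identityʳ (seq x n))
            }
          ; inverse = (λ x → pointwise λ n → ℚ.+-inverseˡ (seq x n))
                    , (λ x → pointwise λ n → ℚ.+-inverseʳ (seq x n))
          ; ⁻¹-cong = -‿cong
          }
        ; comm = λ x y → pointwise λ n → ℚ.+-comm (seq x n) (seq y n)
        }
      ; *-cong = *-cong
      ; *-assoc = λ x y z → pointwise λ n → ℚ.*-assoc (seq x n) (seq y n) (seq z n)
      ; *-identity = (λ x → pointwise λ n → ℚ.*-identityˡ (seq x n))
                   , (λ x → pointwise λ n → ℚ.*-identityʳ (seq x n))
      ; distrib = (λ x y z → pointwise λ n → ℚ.*-distribˡ-+ (seq x n) (seq y n) (seq z n))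
                , (λ x y z → pointwise λ n → ℚ.*-distribʳ-+ (seq x n) (seq y n) (seq z n))
      }
    ; *-comm = λ x y → pointwise λ n → ℚ.*-comm (seq x n) (seq y n)
    }
  }

open import Algebra.Properties.Semiring.Exp (CommutativeRing.semiring ℝ-commutativeRing)
  public using (_^_)

ζ : ℕ → ℕ
ζ n with parity n
... | 0ℙ = 0
... | 1ℙ = 1

χ : (a b : ℝ) → ℕ → ℝ
χ a b n with parity n
... | 0ℙ = a
... | 1ℙ = b

horadam : (a b c w₀ w₁ : ℝ) → ℕ → ℝ
horadam a b c w₀ w₁ 0             = w₀
horadam a b c w₀ w₁ 1             = w₁
horadam a b c w₀ w₁ (suc (suc n)) =
  χ a b (suc (suc n)) * horadam a b c w₀ w₁ (suc n) + c * horadam a b c w₀ w₁ n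

fibonacci : (a b c : ℝ) → ℕ → ℝ
fibonacci a b c = horadam a b c 0ℝ 1ℝ

{-# OPTIONS --safe #-}
module Submission where

open import Algebra.Bundles using (CommutativeRing)
import Algebra.Solver.Ring.NaturalCoefficients.Default as SemiringSolver
open import Algebra.Core using (Op₁; Op₂)
open import Algebra.Structures using (IsCommutativeRing)
open import Data.Nat.Base as ℕ using (ℕ; zero; suc; parity)
import Data.Nat.Properties as ℕ
open import Data.Parity.Base as ℙ using (Parity; 0ℙ; 1ℙ; _⁻¹)
import Data.Parity.Properties as ℙ
open import Data.Product.Base using (_,_)
open import Data.Rational.Base as ℚ using (0ℚ)
import Data.Rational.Properties as ℚ
open import Relation.Binary.Core using (Rel)
open import Relation.Binary.PropositionalEquality as ≡ using (_≡_)
import Relation.Binary.Reasoning.Setoid as SetoidReasoning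

-- The weights r ^ (ζ (n + 1) ζ p), with r = b / a, trade the coefficient χ n of
-- the Fibonacci recurrence for the shifted coefficient χ (n + p), because r a = b.
-- Hence n ↦ r ^ (ζ (n + 1) ζ p) u n satisfies the same recurrence as n ↦ w (n + p),
-- and so does the right-hand side of the identity; the two agree at n = 1, 2.

-- `ζ` and `χ` depend on an index only through its parity. Read as functions of a parity, they
-- reduce the exchange of coefficients to four cases.
bit : Parity → ℕ
bit 0ℙ = 0
bit 1ℙ = 1

select : ∀ {k} {A : Set k} → A → A → Parity → A
select a b 0ℙ = a
select a b 1ℙ = b

module Biperiodic {k ℓ} (R : CommutativeRing k ℓ) where

  open CommutativeRing R renaming (Carrier to A)
  open SetoidReasoning setoid
  open SemiringSolver commutativeSemiring using (solve; _:=_; _:+_; _:*_)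

  quotient-cancel : ∀ a b {i r} → a * i ≈ 1# → r ≈ b * i → r * a ≈ b
  quotient-cancel a b {i} {r} ai≈1 r≈bi = begin
    r * a        ≈⟨ *-congʳ r≈bi ⟩
    b * i * a    ≈⟨ *-assoc b i a ⟩
    b * (i * a)  ≈⟨ *-congˡ (*-comm i a) ⟩
    b * (a * i)  ≈⟨ *-congˡ ai≈1 ⟩
    b * 1#       ≈⟨ *-identityʳ b ⟩
    b            ∎

  -- If `ρ` is even, both exponents vanish and the coefficient is unchanged. If `ρ` is odd, the
  -- coefficient switches: for even `π` the factor `pow 1` on the left turns `a` into `b`, for odd
  -- `π` the one on the right does.
  select-shift : ∀ a b (pow : ℕ → A) → pow 0 ≈ 1# → pow 1 * a ≈ b → ∀ π ρ →
    pow (bit (π ⁻¹) ℕ.* bit ρ) * select a b π ≈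
    select a b (π ℙ.+ ρ) * pow (bit π ℕ.* bit ρ)
  select-shift a b pow pow₀≈1 pow₁a≈b 0ℙ 0ℙ = *-comm (pow 0) a
  select-shift a b pow pow₀≈1 pow₁a≈b 1ℙ 0ℙ = *-comm (pow 0) b
  select-shift a b pow pow₀≈1 pow₁a≈b 0ℙ 1ℙ = begin
    pow 1 * a  ≈⟨ pow₁a≈b ⟩
    b          ≈⟨ *-identityʳ b ⟨
    b * 1#     ≈⟨ *-congˡ pow₀≈1 ⟨
    b * pow 0  ∎
  select-shift a b pow pow₀≈1 pow₁a≈b 1ℙ 1ℙ = begin
    pow 0 * b  ≈⟨ *-congʳ pow₀≈1 ⟩
    1# * b     ≈⟨ *-identityˡ b ⟩
    b          ≈⟨ pow₁a≈b ⟨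
    pow 1 * a  ≈⟨ *-comm (pow 1) a ⟩
    a * pow 1  ∎

  χ-shift : ∀ a b (pow : ℕ → A) → pow 0 ≈ 1# → pow 1 * a ≈ b →
    (ζ : ℕ → ℕ) → (∀ n → ζ n ≡ bit (parity n)) →
    (χ : ℕ → A) → (∀ n → χ n ≡ select a b (parity n)) →
    ∀ n p → pow (ζ (suc n) ℕ.* ζ p) * χ n ≈ χ (n ℕ.+ p) * pow (ζ n ℕ.* ζ p)
  χ-shift a b pow pow₀≈1 pow₁a≈b ζ ζ≡bit χ χ≡select n p
    rewrite ζ≡bit (suc n) | ζ≡bit n | ζ≡bit p | χ≡select n | χ≡select (n ℕ.+ p)
          -- `parity` computes in steps of two, so the last equation makes `parity (suc n)` the
          -- opposite of `parity n`.
          | ℙ.+-homo-+ n p | ≡.sym (ℙ.suc-homo-⁻¹ (suc n)) =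
    select-shift a b pow pow₀≈1 pow₁a≈b (parity n) (parity p)

  -- The addition formula over a commutative ring.

  Recurrence : (ℕ → A) → A → (ℕ → A) → Set ℓ
  Recurrence χ c w = ∀ n → w (suc (suc n)) ≈ χ (suc (suc n)) * w (suc n) + c * w n

  module _
    (χ : ℕ → A) (c : A) (θ : ℕ → ℕ → A)
    (θ-zero   : ∀ p → θ 0 p ≈ 1#)
    (θ-period : ∀ n p → θ (suc (suc n)) p ≈ θ n p)
    (θ-shift  : ∀ n p → θ (suc n) p * χ n ≈ χ (n ℕ.+ p) * θ n p)
    (u : ℕ → A) (u-rec : Recurrence χ c u)
    where

    -- Here `θ n p` plays the role of r ^ (ζ n ζ p). The second summand of the identity has this
    -- form too: its exponent ζ(n) ζ(p + 1) is the one at indices n - 1 and p + 1.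
    weighted : ℕ → ℕ → A
    weighted n p = θ (suc n) p * u n

    weighted-recurrence : ∀ n p →
      weighted (suc (suc n)) p ≈
      χ (suc (suc n) ℕ.+ p) * weighted (suc n) p + c * weighted n p
    weighted-recurrence n p = begin
      t * u (suc (suc n))
        ≈⟨ *-congˡ (u-rec n) ⟩
      t * (x * u (suc n) + c * u n)
        ≈⟨ solve 5 (λ t x u₁ c u₀ → t :* (x :* u₁ :+ c :* u₀) := (t :* x) :* u₁ :+ c :* (t :* u₀))
             refl t x (u (suc n)) c (u n) ⟩
      (t * x) * u (suc n) + c * (t * u n)
        -- The shift law carries the weight past `x`, which becomes `y`; period two lowers the
        -- weight of the last term from index n + 3 to n + 1.
        ≈⟨ +-cong (*-congʳ (θ-shift (suc (suc n)) p)) (*-congˡ (*-congʳ (θ-period (suc n) p))) ⟩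
      (y * θ (suc (suc n)) p) * u (suc n) + c * weighted n p
        ≈⟨ +-congʳ (*-assoc y (θ (suc (suc n)) p) (u (suc n))) ⟩
      y * weighted (suc n) p + c * weighted n p ∎
      where
      t = θ (suc (suc (suc n))) p
      x = χ (suc (suc n))
      y = χ (suc (suc n) ℕ.+ p)

    module _ (u₀≈0 : u 0 ≈ 0#) (u₁≈1 : u 1 ≈ 1#)
             (w : ℕ → A) (w-rec : Recurrence χ c w) where

      weighted₀ : ∀ p → weighted 0 p ≈ 0#
      weighted₀ p = trans (*-congˡ u₀≈0) (zeroʳ (θ 1 p))

      weighted₁ : ∀ p → weighted 1 p ≈ 1#
      weighted₁ p = begin
        θ 2 p * u 1  ≈⟨ *-cong (trans (θ-period 0 p) (θ-zero p)) u₁≈1 ⟩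
        1# * 1#      ≈⟨ *-identityˡ 1# ⟩
        1#           ∎

      weighted₂ : ∀ p → weighted 2 p ≈ χ (2 ℕ.+ p)
      weighted₂ p = begin
        weighted 2 p
          ≈⟨ weighted-recurrence 0 p ⟩
        χ (2 ℕ.+ p) * weighted 1 p + c * weighted 0 p
          ≈⟨ +-cong (*-congˡ (weighted₁ p)) (*-congˡ (weighted₀ p)) ⟩
        χ (2 ℕ.+ p) * 1# + c * 0#
          ≈⟨ +-cong (*-identityʳ (χ (2 ℕ.+ p))) (zeroʳ c) ⟩
        χ (2 ℕ.+ p) + 0#
          ≈⟨ +-identityʳ (χ (2 ℕ.+ p)) ⟩
        χ (2 ℕ.+ p) ∎

      -- Two-step induction on `n`, as the recurrence has order two. In the base cases the
      -- coefficients of w(p + 1) and c w(p) are 1, 0 and then χ(p + 2), 1.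
      weighted-addition : ∀ n p →
        w (suc n ℕ.+ p) ≈ weighted (suc n) p * w (suc p) + c * weighted n (suc p) * w p
      weighted-addition zero p = begin
        w (suc p)
          ≈⟨ *-identityˡ (w (suc p)) ⟨
        1# * w (suc p)
          ≈⟨ +-identityʳ (1# * w (suc p)) ⟨
        1# * w (suc p) + 0#
          ≈⟨ +-congˡ (trans (*-congʳ (zeroʳ c)) (zeroˡ (w p))) ⟨
        1# * w (suc p) + c * 0# * w p
          ≈⟨ +-cong (*-congʳ (weighted₁ p)) (*-congʳ (*-congˡ (weighted₀ (suc p)))) ⟨
        weighted 1 p * w (suc p) + c * weighted 0 (suc p) * w p ∎
      weighted-addition (suc zero) p = begin
        w (suc (suc p))
          ≈⟨ w-rec p ⟩
        χ (2 ℕ.+ p) * w (suc p) + c * w p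
          ≈⟨ +-congˡ (*-congʳ (*-identityʳ c)) ⟨
        χ (2 ℕ.+ p) * w (suc p) + c * 1# * w p
          ≈⟨ +-cong (*-congʳ (weighted₂ p)) (*-congʳ (*-congˡ (weighted₁ (suc p)))) ⟨
        weighted 2 p * w (suc p) + c * weighted 1 (suc p) * w p ∎
      weighted-addition (suc (suc n)) p = begin
        w (suc (suc (suc n)) ℕ.+ p)
          ≈⟨ w-rec (suc n ℕ.+ p) ⟩
        x * w (suc (suc n) ℕ.+ p) + c * w (suc n ℕ.+ p)
          ≈⟨ +-cong (*-congˡ (weighted-addition (suc n) p)) (*-congˡ (weighted-addition n p)) ⟩
        x * (e₂ * w (suc p) + c * f₁ * w p) + c * (e₁ * w (suc p) + c * f₀ * w p)
          ≈⟨ solve 8 (λ x c e₂ e₁ f₁ f₀ w₁ w₀ →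
               x :* (e₂ :* w₁ :+ c :* f₁ :* w₀) :+ c :* (e₁ :* w₁ :+ c :* f₀ :* w₀)
               := (x :* e₂ :+ c :* e₁) :* w₁ :+ c :* (x :* f₁ :+ c :* f₀) :* w₀)
               refl x c e₂ e₁ f₁ f₀ (w (suc p)) (w p) ⟩
        (x * e₂ + c * e₁) * w (suc p) + c * (x * f₁ + c * f₀) * w p
          ≈⟨ +-cong (*-congʳ (weighted-recurrence (suc n) p)) (*-congʳ (*-congˡ f-recurrence)) ⟨
        weighted (suc (suc (suc n))) p * w (suc p)
          + c * weighted (suc (suc n)) (suc p) * w p ∎
        where
        x  = χ (suc (suc (suc n)) ℕ.+ p)
        e₁ = weighted (suc n) p
        e₂ = weighted (suc (suc n)) p
        f₀ = weighted n (suc p)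
        f₁ = weighted (suc n) (suc p)
        f-recurrence : weighted (suc (suc n)) (suc p) ≈ x * f₁ + c * f₀
        -- Since n + (p + 1) = (n + 1) + p, the second summand has the same coefficient `x` as the
        -- first, so the two recurrences combine.
        f-recurrence = ≡.subst
          (λ m → weighted (suc (suc n)) (suc p) ≈ χ (suc (suc m)) * f₁ + c * f₀)
          (ℕ.+-suc n p) (weighted-recurrence n (suc p))

      addition : ∀ n p →
        w (suc n ℕ.+ p) ≈
        θ (suc (suc n)) p * u (suc n) * w (suc p) + c * θ (suc n) (suc p) * u n * w p
      addition n p = trans (weighted-addition n p)
        (+-congˡ (*-congʳ (sym (*-assoc c (θ (suc n) (suc p)) (u n)))))

-- The operations are separate parameters here because at ℝ the type checker would
-- otherwise unfold the operations projected from a bundle, and those of Defs, down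
-- to Cauchy sequences in order to compare them.
module Unbundled {k ℓ} {A : Set k} (_≈_ : Rel A ℓ) (_+_ _*_ : Op₂ A) (-_ : Op₁ A) (0# 1# : A)
                 (isCommutativeRing : IsCommutativeRing _≈_ _+_ _*_ -_ 0# 1#) where

  private
    commutativeRing : CommutativeRing k ℓ
    commutativeRing = record { isCommutativeRing = isCommutativeRing }

    module B = Biperiodic commutativeRing

  open IsCommutativeRing isCommutativeRing using (reflexive)

  addition : ∀ a b c i → (a * i) ≈ 1# →
    (pow : ℕ → A) → pow 0 ≈ 1# → pow 1 ≈ (b * i) →
    (ζ : ℕ → ℕ) → (∀ n → ζ n ≡ bit (parity n)) →
    (χ : ℕ → A) → (∀ n → χ n ≡ select a b (parity n)) →
    (u : ℕ → A) → (∀ n → u (suc (suc n)) ≈ ((χ (suc (suc n)) * u (suc n)) + (c * u n))) →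
    u 0 ≈ 0# → u 1 ≈ 1# →
    (w : ℕ → A) → (∀ n → w (suc (suc n)) ≈ ((χ (suc (suc n)) * w (suc n)) + (c * w n))) →
    ∀ n p {n⁻ n⁺ p⁺ x y} → n ≡ suc n⁻ → n⁺ ≡ suc n → p⁺ ≡ suc p →
    x ≡ pow (ζ n⁺ ℕ.* ζ p) → y ≡ pow (ζ n ℕ.* ζ p⁺) →
    w (n ℕ.+ p) ≈ (((x * u n) * w p⁺) + (((c * y) * u n⁻) * w p))
  addition a b c i ai≈1 pow pow₀≈1 pow₁≈bi ζ ζ≡bit χ χ≡select u u-rec u₀≈0 u₁≈1 w w-rec
           _ p {n⁻} ≡.refl ≡.refl ≡.refl ≡.refl ≡.refl =
    B.addition χ c (λ n p → pow (ζ n ℕ.* ζ p)) θ-zero θ-period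
      (B.χ-shift a b pow pow₀≈1 (B.quotient-cancel a b ai≈1 pow₁≈bi) ζ ζ≡bit χ χ≡select)
      u u-rec u₀≈0 u₁≈1 w w-rec n⁻ p
    where
    θ-zero : ∀ p → pow (ζ 0 ℕ.* ζ p) ≈ 1#
    θ-zero p rewrite ζ≡bit 0 = pow₀≈1
    θ-period : ∀ n p → pow (ζ (suc (suc n)) ℕ.* ζ p) ≈ pow (ζ n ℕ.* ζ p)
    -- `parity (suc (suc n))` computes to `parity n`.
    θ-period n p = reflexive (≡.cong (λ z → pow (z ℕ.* ζ p))
      (≡.trans (ζ≡bit (suc (suc n))) (≡.sym (ζ≡bit n))))

-- Specialisation to the real numbers.

open import Defs

open Unbundled _≈_ _+_ _*_ -_ 0ℝ 1ℝ (CommutativeRing.isCommutativeRing ℝ-commutativeRing)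
  using (addition)

pointwise : ∀ {x y} → (∀ n → seq x n ≡ seq y n) → x ≈ y
pointwise {x} {y} x≡y = mk≈ λ ε ε>0 → 0 , λ n _ →
  ≡.subst (λ q → ℚ.∣ q ∣ ℚ.< ε) (≡.sym (x-y≡0 n)) ε>0
  where
  x-y≡0 : ∀ n → seq x n ℚ.- seq y n ≡ 0ℚ
  x-y≡0 n = ≡.trans (≡.cong (ℚ._- seq y n) (x≡y n)) (ℚ.+-inverseʳ (seq y n))

ζ≡bit : ∀ n → ζ n ≡ bit (parity n)
ζ≡bit n with parity n
... | 0ℙ = ≡.refl
... | 1ℙ = ≡.refl

χ≡select : ∀ a b n → χ a b n ≡ select a b (parity n)
χ≡select a b n with parity n
... | 0ℙ = ≡.refl
... | 1ℙ = ≡.refl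

^-zero : ∀ x → x ^ 0 ≈ 1ℝ
^-zero x = pointwise {x ^ 0} {1ℝ} λ _ → ≡.refl

^-one : ∀ x → x ^ 1 ≈ x
^-one x = pointwise {x ^ 1} {x} λ n → ℚ.*-identityʳ (seq x n)

horadam-recurrence : ∀ a b c w₀ w₁ n →
  horadam a b c w₀ w₁ (suc (suc n)) ≈
  χ a b (suc (suc n)) * horadam a b c w₀ w₁ (suc n) + c * horadam a b c w₀ w₁ n
horadam-recurrence a b c w₀ w₁ n = pointwise λ _ → ≡.refl

fibonacci-recurrence : ∀ a b c n →
  fibonacci a b c (suc (suc n)) ≈
  χ a b (suc (suc n)) * fibonacci a b c (suc n) + c * fibonacci a b c n
fibonacci-recurrence a b c n = pointwise λ _ → ≡.refl

horadam-addition :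
  ∀ a b c w₀ w₁ (a#0 : a # 0ℝ) n p n⁻ n⁺ p⁺ x y →
  n ≡ suc n⁻ → n⁺ ≡ suc n → p⁺ ≡ suc p →
  x ≡ (b / a [ a#0 ]) ^ (ζ n⁺ ℕ.* ζ p) →
  y ≡ (b / a [ a#0 ]) ^ (ζ n ℕ.* ζ p⁺) →
  horadam a b c w₀ w₁ (n ℕ.+ p) ≈
    x * fibonacci a b c n * horadam a b c w₀ w₁ p⁺
    + c * y * fibonacci a b c n⁻ * horadam a b c w₀ w₁ p
horadam-addition a b c w₀ w₁ a#0 n p n⁻ n⁺ p⁺ x y =
  -- The base of the powers is b times the inverse of a, so its first power times a is b.
  addition a b c (inverse a a#0) (*-inverseʳ a a#0)
    ((b / a [ a#0 ]) ^_) (^-zero (b / a [ a#0 ])) (^-one (b / a [ a#0 ]))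
    ζ ζ≡bit (χ a b) (χ≡select a b)
    (fibonacci a b c) (fibonacci-recurrence a b c)
    (pointwise λ _ → ≡.refl) (pointwise λ _ → ≡.refl)
    (horadam a b c w₀ w₁) (horadam-recurrence a b c w₀ w₁)
    n p {n⁻} {n⁺} {p⁺} {x} {y}

-- Agda does not recognise x ^ n elaborated in a type signature as syntactically
-- equal to x ^ n elaborated in a proof term, and then unfolds the surrounding real
-- operations. Powers are therefore passed as variables x and y with equations, as
-- are the indices n⁻, n⁺ and p⁺ above.
substitute-powers :
  ∀ r k l s c u w u′ w′ {x y} → x ≡ r ^ k → y ≡ r ^ l →
  s ≈ x * u * w + c * y * u′ * w′ → s ≈ r ^ k * u * w + c * r ^ l * u′ * w′
substitute-powers _ _ _ _ _ _ _ _ _ ≡.refl ≡.refl eq = eq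

replace-powers :
  ∀ r k l s c u w u′ w′ {x y} → x ≡ r ^ k → y ≡ r ^ l →
  (∀ x y → x ≡ r ^ k → y ≡ r ^ l → s ≈ x * u * w + c * y * u′ * w′) →
  s ≈ r ^ k * u * w + c * r ^ l * u′ * w′
replace-powers r k l s c u w u′ w′ {x} {y} x≡ y≡ h =
  substitute-powers r k l s c u w u′ w′ x≡ y≡ (h x y x≡ y≡)

theorem3 :
    (a b c w₀ w₁ : ℝ) (a#0 : a # 0ℝ) (b#0 : b # 0ℝ) (c#0 : c # 0ℝ)
    (n p : ℕ) → n ℕ.> 0 → p ℕ.> 0 →
    let w = horadam a b c w₀ w₁
        u = fibonacci a b c
    in w (n ℕ.+ p)
         ≈ ((b / a [ a#0 ]) ^ (ζ (n ℕ.+ 1) ℕ.* ζ p)) * u n * w (p ℕ.+ 1)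
           + c * ((b / a [ a#0 ]) ^ (ζ n ℕ.* ζ (p ℕ.+ 1))) * u (n ℕ.∸ 1) * w p
theorem3 a b c w₀ w₁ a#0 _ _ n p n>0 _ =
  replace-powers (b / a [ a#0 ]) (ζ (n ℕ.+ 1) ℕ.* ζ p) (ζ n ℕ.* ζ (p ℕ.+ 1))
    (horadam a b c w₀ w₁ (n ℕ.+ p)) c (fibonacci a b c n) (horadam a b c w₀ w₁ (p ℕ.+ 1))
    (fibonacci a b c (n ℕ.∸ 1)) (horadam a b c w₀ w₁ p)
    ≡.refl ≡.refl
    λ x y x≡ y≡ → horadam-addition a b c w₀ w₁ a#0 n p (n ℕ.∸ 1) (n ℕ.+ 1) (p ℕ.+ 1) x y
      -- `n>0` unfolds to 1 ≤ n, so the truncated `n ∸ 1` is a true predecessor.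
      (≡.sym (ℕ.m+[n∸m]≡n n>0)) (ℕ.+-comm n 1) (ℕ.+-comm p 1) x≡ y≡
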